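{- Let $(G,w)$ be a distinct weighted pair graph with vertex set $V$, arc set $A$ and $q=|A|$, and let $k$ be a natural number. If there exists a vertex $v\in V$ with $\mathrm{getL}(q/2,v)=k$, then there exists a decreasing trail of $(G,w)$ of length $k$.
   Context: Let $U$ be a linearly ordered set. A distinct weighted pair graph consists of a digraph $G=(V,A)$ with $V\subseteq U$ finite, $|V|\ge 1$, $A\subseteq V\times V$, without loops ($(x,x)\notin A$) and symmetric ($(x,y)\in A\Rightarrow (y,x)\in A$), so that $q=|A|$ is even and each undirected edge is counted twice, together with a function $w:U\times U\to\mathbb{R}$ such that: (i) $w(e)\in\{1,2,\ldots,q/2\}$ for every $e\in A$; (ii) for all $v_1,v_2\in U$: $(v_1,v_2)\notin A$ if and only if $w(v_1,v_2)=0$; (iii) for all $(v_1,v_2),(u_1,u_2)\in A$: $w(v_1,v_2)=w(u_1,u_2)$ if and only if $(v_1,v_2)=(u_1,u_2)$ or $(v_1,v_2)=(u_2,u_1)$. A decreasing trail of $(G,w)$ of length $k\ge 0$ is a list $[(x_1,y_1),\ldots,(x_k,y_k)]$ of arcs in $A$ with $y_i=x_{i+1}$ and $w(x_i,y_i)>w(x_{i+1},y_{i+1})$ for all $1\le i<k$. The labelling $\mathrm{getL}$ is computed recursively. Fix a list enumerating $A$, and for each $j\in\{1,\ldots,q/2\}$ let $(a_j,b_j)$ be the first arc in the list with weight $j$ (such an arc exists and is unique up to swapping its endpoints). For $v\in V$ put $\mathrm{getL}(0,v)=0$ and, for $0\le i<q/2$, $$\mathrm{getL}(i+1,v)=\begin{cases}\max(\mathrm{getL}(i,b_{i+1})+1,\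 \mathrm{getL}(i,v)) & \text{if } v=a_{i+1},\\ \max(\mathrm{getL}(i,a_{i+1})+1,\ \mathrm{getL}(i,v)) & \text{if } v=b_{i+1},\\ \mathrm{getL}(i,v) & \text{otherwise.}\end{cases}$$ -}

module Defs where

open import Level using (_⊔_)
open import Data.Bool.Base using (Bool; true; false; if_then_else_)
open import Data.Nat.Base as ℕ using (ℕ; zero; suc; s≤s)
import Data.Nat.Properties as ℕₚ
open import Data.Nat.DivMod using (_/_; m/n*n≤m)
open import Data.Integer.Base as ℤ using (+_)
import Data.Integer.Properties as ℤₚ
open import Data.Rational.Base as ℚ using (ℚ; 1ℚ)
import Data.Rational.Properties as ℚₚ
import Data.Rational.Unnormalised.Base as ℚᵘ
open import Data.Fin.Base as Fin using (Fin; zero; suc; toℕ; fromℕ<)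
import Data.Fin.Properties as Finₚ
open import Data.List.Base using (List; []; _∷_; length; find; lookup)
open import Data.List.Membership.Propositional using (_∈_; _∉_) renaming (find to find∈)
open import Data.List.Membership.Propositional.Properties using (∈-lookup)
import Data.List.Membership.DecPropositional as DecMembership
open import Data.List.Relation.Unary.All as All using (All)
open import Data.List.Relation.Unary.Any as Any using (Any; here; there)
import Data.List.Relation.Unary.AllPairs as AllPairs
open import Data.List.Relation.Unary.Linked using (Linked)
open import Data.List.Relation.Unary.Unique.Propositional using (Unique)
open import Data.Maybe.Base using (Maybe; just; nothing)
open import Data.Product.Base using (∃; ∃₂; ∃-syntax; _×_; _,_; proj₁; proj₂; swap)
open import Data.Product.Properties using (≡-dec)
open import Data.Sum.Base using (_⊎_; inj₁; inj₂)
open import Function.Base using (_∘_)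
open import Function.Bundles using (_⇔_; mk⇔; Equivalence)
open import Relation.Binary.Core using (Rel)
open import Relation.Binary.Definitions using (tri<; tri≈; tri>)
open import Relation.Binary.Structures using (IsStrictTotalOrder)
open import Relation.Binary.PropositionalEquality
open import Relation.Nullary using (¬_; Dec; yes; no; does; contradiction)
open import Relation.Nullary.Decidable using (map′)
open import Relation.Unary using (Pred; Decidable)

------------------------------------------------------------------------
-- Real numbers, as two-sided Dedekind cuts of ℚ

record ℝ : Set₁ where
  no-eta-equality
  field
    lower upper     : Pred ℚ Level.zero
    lower-inhabited : ∃ lower
    upper-inhabited : ∃ upper
    lower-rounded   : ∀ p → lower p ⇔ (∃[ r ] p ℚ.< r × lower r)
    upper-rounded   : ∀ p → upper p ⇔ (∃[ r ] r ℚ.< p × upper r)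
    disjoint        : ∀ p → ¬ (lower p × upper p)
    located         : ∀ {p r} → p ℚ.< r → lower p ⊎ upper r

open ℝ

infix 4 _≃_ _<ℝ_

record _≃_ (x y : ℝ) : Set where
  constructor mk≃
  field
    lower⇔ : ∀ p → lower x p ⇔ lower y p
    upper⇔ : ∀ p → upper x p ⇔ upper y p

_<ℝ_ : Rel ℝ Level.zero
x <ℝ y = ∃[ p ] upper x p × lower y p

fromℚ : ℚ → ℝ
fromℚ q .lower p                = p ℚ.< q
fromℚ q .upper p                = q ℚ.< p
fromℚ q .lower-inhabited        = q ℚ.+ ℚ.- 1ℚ ,
  subst (q ℚ.+ ℚ.- 1ℚ ℚ.<_) (ℚₚ.+-identityʳ q) (ℚₚ.+-monoʳ-< q (ℚₚ.negative⁻¹ (ℚ.- 1ℚ)))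
fromℚ q .upper-inhabited        = q ℚ.+ 1ℚ ,
  subst (ℚ._< q ℚ.+ 1ℚ) (ℚₚ.+-identityʳ q) (ℚₚ.+-monoʳ-< q (ℚₚ.positive⁻¹ 1ℚ))
fromℚ q .lower-rounded p        = mk⇔ ℚₚ.<-dense (λ (_ , p<r , r<q) → ℚₚ.<-trans p<r r<q)
fromℚ q .upper-rounded p        = mk⇔
  (λ q<p → let (r , q<r , r<p) = ℚₚ.<-dense q<p in r , r<p , q<r)
  (λ (_ , r<p , q<r) → ℚₚ.<-trans q<r r<p)
fromℚ q .disjoint p (p<q , q<p) = ℚₚ.<-asym p<q q<p
fromℚ q .located {p} p<r with ℚₚ.<-cmp p q
... | tri< p<q _ _  = inj₁ p<q
... | tri≈ _ refl _ = inj₂ p<r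
... | tri> _ _ q<p  = inj₂ (ℚₚ.<-trans q<p p<r)

fromℕ : ℕ → ℝ
fromℕ n = fromℚ (+ n ℚ./ 1)

≃-sym : ∀ {x y} → x ≃ y → y ≃ x
≃-sym (mk≃ l u) = mk≃
  (λ p → mk⇔ (Equivalence.from (l p)) (Equivalence.to (l p)))
  (λ p → mk⇔ (Equivalence.from (u p)) (Equivalence.to (u p)))

≃-trans : ∀ {x y z} → x ≃ y → y ≃ z → x ≃ z
≃-trans (mk≃ l u) (mk≃ l′ u′) = mk≃
  (λ p → mk⇔ (Equivalence.to (l′ p) ∘ Equivalence.to (l p))
             (Equivalence.from (l p) ∘ Equivalence.from (l′ p)))
  (λ p → mk⇔ (Equivalence.to (u′ p) ∘ Equivalence.to (u p))
             (Equivalence.from (u p) ∘ Equivalence.from (u′ p)))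

fromℚ-injective : ∀ {p q} → fromℚ p ≃ fromℚ q → p ≡ q
fromℚ-injective {p} {q} (mk≃ l _) with ℚₚ.<-cmp p q
... | tri< p<q _ _ = contradiction (Equivalence.from (l p) p<q) (ℚₚ.<-irrefl refl)
... | tri≈ _ p≡q _ = p≡q
... | tri> _ _ q<p = contradiction (Equivalence.to (l q) q<p) (ℚₚ.<-irrefl refl)

fromℕ-injective : ∀ {m n} → fromℕ m ≃ fromℕ n → m ≡ n
fromℕ-injective {m} {n} eq
  with ℚₚ./-injective-≃ (ℚᵘ.mkℚᵘ (+ m) 0) (ℚᵘ.mkℚᵘ (+ n) 0) (fromℚ-injective eq)
... | ℚᵘ.*≡* m*1≡n*1 = ℤₚ.+-injective (ℤₚ.*-cancelʳ-≡ (+ m) (+ n) (+ 1) m*1≡n*1)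

------------------------------------------------------------------------
-- Finite sets

record FiniteSet {a} (X : Set a) : Set a where
  field
    elements : List X
    unique   : Unique elements

open FiniteSet using (elements)

infix 4 _∈ₛ_ _∉ₛ_

_∈ₛ_ _∉ₛ_ : ∀ {a} {X : Set a} → X → FiniteSet X → Set a
x ∈ₛ S = x ∈ elements S
x ∉ₛ S = x ∉ elements S

∣_∣ : ∀ {a} {X : Set a} → FiniteSet X → ℕ
∣ S ∣ = length (elements S)

-- Repetitions in the list are allowed.
infix 4 _Enumerates_

_Enumerates_ : ∀ {a} {X : Set a} → List X → FiniteSet X → Set a
xs Enumerates S = ∀ x → x ∈ xs ⇔ x ∈ₛ S

------------------------------------------------------------------------
-- Distinct weighted pair graphs

record DistinctWeightedPairGraph {a} (U : Set a) : Set (a ⊔ Level.suc Level.zero) where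
  field
    V         : FiniteSet U
    A         : FiniteSet (U × U)
    nonempty  : ∣ V ∣ ℕ.≥ 1
    A⊆V×V     : ∀ {x y} → (x , y) ∈ₛ A → x ∈ₛ V × y ∈ₛ V
    loopless  : ∀ {x} → (x , x) ∉ₛ A
    symmetric : ∀ {x y} → (x , y) ∈ₛ A → (y , x) ∈ₛ A
    w         : U × U → ℝ

  q : ℕ
  q = ∣ A ∣

  field
    weight-range    : ∀ {e} → e ∈ₛ A → ∃[ j ] 1 ℕ.≤ j × j ℕ.≤ q / 2 × w e ≃ fromℕ j
    weight-zero     : ∀ v₁ v₂ → ((v₁ , v₂) ∉ₛ A) ⇔ (w (v₁ , v₂) ≃ fromℕ 0)
    weight-distinct : ∀ {v₁ v₂ u₁ u₂} → (v₁ , v₂) ∈ₛ A → (u₁ , u₂) ∈ₛ A →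
                      (w (v₁ , v₂) ≃ w (u₁ , u₂)) ⇔
                      ((v₁ , v₂) ≡ (u₁ , u₂) ⊎ (v₁ , v₂) ≡ (u₂ , u₁))

module _ {a} {U : Set a} (G : DistinctWeightedPairGraph U) where
  open DistinctWeightedPairGraph G

  DecreasingStep : Rel (U × U) a
  DecreasingStep (x , y) (x′ , y′) = y ≡ x′ × w (x′ , y′) <ℝ w (x , y)

  record IsDecreasingTrail (es : List (U × U)) : Set a where
    field
      arcs       : All (_∈ₛ A) es
      decreasing : Linked DecreasingStep es

------------------------------------------------------------------------
-- The labelling

module _ {a ℓ} {U : Set a} {_<_ : Rel U ℓ} (isSTO : IsStrictTotalOrder _≡_ _<_)
         (G : DistinctWeightedPairGraph U) where
  open DistinctWeightedPairGraph G
  open IsStrictTotalOrder isSTO using (_≟_; _<?_; compare)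

  private
    _≟₂_ : (e f : U × U) → Dec (e ≡ f)
    _≟₂_ = ≡-dec _≟_ _≟_

    open DecMembership _≟₂_ using (_∈?_)

  abstract
    -- Equality of reals is not decidable in general, but every weight is a
    -- natural number.
    naturalWeight : ∀ e → ∃[ n ] w e ≃ fromℕ n
    naturalWeight e with e ∈? elements A
    ... | yes e∈A = let (j , _ , _ , we≃j) = weight-range e∈A in j , we≃j
    ... | no  e∉A = 0 , Equivalence.to (weight-zero (proj₁ e) (proj₂ e)) e∉A

    hasWeight? : ∀ j → Decidable (λ e → w e ≃ fromℕ j)
    hasWeight? j e =
      let (n , we≃n) = naturalWeight e in
      map′ (λ n≡j → subst (λ n → w e ≃ fromℕ n) n≡j we≃n)
           (λ we≃j → fromℕ-injective (≃-trans (≃-sym we≃n) we≃j))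
           (n ℕₚ.≟ j)

  firstArc : List (U × U) → ℕ → Maybe (U × U)
  firstArc arcs j = find (hasWeight? j) arcs

  -- The case nothing does not occur in the recursion up to q / 2 if arcs
  -- enumerates A: see firstArc-exists below.
  relabel : Maybe (U × U) → (U → ℕ) → U → ℕ
  relabel nothing        L v = L v
  relabel (just (a , b)) L v =
    if does (v ≟ a) then (L b ℕ.+ 1) ℕ.⊔ L v else
    if does (v ≟ b) then (L a ℕ.+ 1) ℕ.⊔ L v else
    L v

  getL : List (U × U) → ℕ → U → ℕ
  getL arcs zero    v = 0
  getL arcs (suc i) v = relabel (firstArc arcs (suc i)) (getL arcs i) v

  private
    find-any : ∀ {p} {P : Pred (U × U) p} (P? : Decidable P) {xs} → Any P xs →
               ∃[ x ] find P? xs ≡ just x × x ∈ xs × P x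
    find-any P? {x ∷ xs} any with P? x | any
    ... | yes px | _         = x , refl , here refl , px
    ... | no ¬px | here px   = contradiction px ¬px
    ... | no ¬px | there any′ =
      let (y , eq , y∈ , py) = find-any P? any′ in y , eq , there y∈ , py

    lookup-unique : ∀ {xs : List (U × U)} → Unique xs → ∀ {i k} → i Fin.< k →
                    lookup xs i ≢ lookup xs k
    lookup-unique (x∉ AllPairs.∷ _) {zero}  {suc k} _         = All.lookup x∉ (∈-lookup k)
    lookup-unique (_ AllPairs.∷ u)  {suc i} {suc k} (s≤s i<k) = lookup-unique u i<k

    orientation : Bool → Fin 2
    orientation false = zero
    orientation true  = suc zero

    swapped-orientation : ∀ {x y} → x ≢ y →
      orientation (does (x <? y)) ≢ orientation (does (y <? x))
    swapped-orientation {x} {y} x≢y with compare x y | compare y x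
    ... | tri< _ _ _    | tri> _ _ _    = λ ()
    ... | tri> _ _ _    | tri< _ _ _    = λ ()
    ... | tri≈ _ x≡y _  | _             = contradiction x≡y x≢y
    ... | _             | tri≈ _ y≡x _  = contradiction (sym y≡x) x≢y
    ... | tri< _ _ y≮x  | tri< y<x _ _  = contradiction y<x y≮x
    ... | tri> x≮y _ _  | tri> _ _ x<y  = contradiction x<y x≮y

    -- Otherwise the q arcs would embed into pairs of an orientation and one of
    -- the remaining q / 2 - 1 weights.
    weight-attained : ∀ {j} → 1 ℕ.≤ j → j ℕ.≤ q / 2 →
                      Any (λ e → w e ≃ fromℕ j) (elements A)
    weight-attained {suc j} _ j<q/2 with Any.any? (hasWeight? (suc j)) (elements A)
    ... | yes any = any
    ... | no none = absurd (q / 2) refl j<q/2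
      where
      absurd : ∀ m → q / 2 ≡ m → suc j ℕ.≤ m →
               Any (λ e → w e ≃ fromℕ (suc j)) (elements A)
      absurd (suc m) q/2≡1+m (s≤s j≤m) = contradiction collision no-collision
        where
        2m<q : m ℕ.* 2 ℕ.< q
        2m<q = ℕₚ.≤-trans (ℕₚ.n≤1+n _)
          (subst (λ n → n ℕ.* 2 ℕ.≤ q) q/2≡1+m (m/n*n≤m q 2))

        j₀ : Fin (suc m)
        j₀ = fromℕ< (s≤s j≤m)

        weightIndex : ∀ {e} → e ∈ₛ A →
                      ∃[ k ] j₀ ≢ k × w e ≃ fromℕ (suc (toℕ {suc m} k))
        weightIndex {e} e∈A with weight-range e∈A
        ... | suc n , _ , n<q/2 , we≃n = fromℕ< n<1+m , j₀≢ , we≃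
          where
          n<1+m : n ℕ.< suc m
          n<1+m = subst (n ℕ.<_) q/2≡1+m n<q/2
          we≃ : w e ≃ fromℕ (suc (toℕ (fromℕ< n<1+m)))
          we≃ rewrite Finₚ.toℕ-fromℕ< n<1+m = we≃n
          j₀≢ : j₀ ≢ fromℕ< n<1+m
          j₀≢ eq with Finₚ.fromℕ<-injective j n (s≤s j≤m) n<1+m eq
          ... | refl = none (Any.map (λ { refl → we≃n }) e∈A)

        arc : Fin q → U × U
        arc i = lookup (elements A) i

        arc∈A : ∀ i → arc i ∈ₛ A
        arc∈A i = ∈-lookup i

        weightCode : Fin q → Fin m
        weightCode i = Fin.punchOut (proj₁ (proj₂ (weightIndex (arc∈A i))))

        orientationCode : Fin q → Fin 2
        orientationCode i = orientation (does (proj₁ (arc i) <? proj₂ (arc i)))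

        code : Fin q → Fin (m ℕ.* 2)
        code i = Fin.combine (weightCode i) (orientationCode i)

        collision : ∃₂ λ i k → i Fin.< k × code i ≡ code k
        collision = Finₚ.pigeonhole 2m<q code

        same-weight : ∀ i k → weightCode i ≡ weightCode k → w (arc i) ≃ w (arc k)
        same-weight i k eq
          with weightIndex (arc∈A i) | weightIndex (arc∈A k)
        ... | n , j₀≢n , wi | n′ , j₀≢n′ , wk
          with Finₚ.punchOut-injective j₀≢n j₀≢n′ eq
        ... | refl = ≃-trans wi (≃-sym wk)

        same-arc : ∀ i k → w (arc i) ≃ w (arc k) → arc i ≡ arc k ⊎ arc i ≡ swap (arc k)
        same-arc i k wi≃wk =
          Equivalence.to (weight-distinct (arc∈A i) (arc∈A k)) wi≃wk

        no-collision : ¬ (∃₂ λ i k → i Fin.< k × code i ≡ code k)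
        no-collision (i , k , i<k , eq)
          with Finₚ.combine-injective (weightCode i) (orientationCode i)
                                      (weightCode k) (orientationCode k) eq
        ... | same-w , same-o with same-arc i k (same-weight i k same-w)
        ... | inj₁ same = lookup-unique (FiniteSet.unique A) i<k same
        ... | inj₂ swapped = swapped-orientation
          (λ x≡y → loopless (subst (λ y → (proj₁ (arc k) , y) ∈ₛ A) (sym x≡y) (arc∈A k)))
          (trans (sym same-o) (cong (λ (x , y) → orientation (does (x <? y))) swapped))

  firstArc-exists : ∀ {arcs} → arcs Enumerates A → ∀ {j} → 1 ℕ.≤ j → j ℕ.≤ q / 2 →
                    ∃[ e ] firstArc arcs j ≡ just e × e ∈ₛ A × w e ≃ fromℕ j
  firstArc-exists {arcs} enum {j} 1≤j j≤q/2 =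
    let (e , eq , e∈arcs , we≃j) = find-any (hasWeight? j) attained
    in e , eq , Equivalence.to (enum e) e∈arcs , we≃j
    where
    attained : Any (λ e → w e ≃ fromℕ j) arcs
    attained = let (e , e∈A , we≃j) = find∈ (weight-attained 1≤j j≤q/2)
               in Any.map (λ { refl → we≃j }) (Equivalence.from (enum e) e∈A)

{-# OPTIONS --safe #-}

-- By induction on i, every vertex v is the start of a decreasing trail of
-- length getL(i, v) whose weights are at most i: the trail at an end of the arc
-- of weight i + 1 is extended by traversing that arc first, from the other end.

module Submission where

open import Defs
open import Data.Nat.Base using (ℕ; zero; suc; _+_; _⊔_; _≤_; z≤n; s≤s)
import Data.Nat.Properties as ℕₚ
open import Data.Nat.DivMod using (_/_)
open import Data.Integer.Base using (+_; +<+)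
import Data.Integer.Properties as ℤₚ
import Data.Rational.Base as ℚ
import Data.Rational.Properties as ℚₚ
import Data.Rational.Unnormalised.Base as ℚᵘ
import Data.Rational.Unnormalised.Properties as ℚᵘₚ
open import Data.List.Base using (List; []; _∷_; length; head)
open import Data.List.Relation.Unary.All using ([]; _∷_)
open import Data.List.Relation.Unary.Linked using ([]; _∷′_)
open import Data.Maybe.Base using (just)
open import Data.Maybe.Relation.Unary.All as Maybe using (just; nothing)
open import Data.Maybe.Relation.Binary.Connected using (Connected; just; just-nothing)
open import Data.Product.Base using (_×_; ∃-syntax; _,_; proj₁; map₂)
open import Data.Sum.Base using (inj₁; inj₂)
open import Function.Bundles using (Equivalence)
open import Relation.Binary.Core using (Rel)
open import Relation.Binary.Structures using (IsStrictTotalOrder)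
open import Relation.Binary.PropositionalEquality using (_≡_; refl; sym; cong; subst; trans)
open import Relation.Nullary using (yes; no)
open DistinctWeightedPairGraph using (V; A; q)

-- `ℚ._/_` normalises, so both sides are carried to unnormalised fractions over 1, where only the
-- numerators are compared.
n/1<1+n/1 : ∀ n → (+ n) ℚ./ 1 ℚ.< (+ suc n) ℚ./ 1
n/1<1+n/1 n = ℚₚ.toℚᵘ-cancel-<
  (ℚᵘₚ.<-respˡ-≃ (ℚᵘₚ.≃-sym (ℚₚ.toℚᵘ-fromℚᵘ (ℚᵘ.mkℚᵘ (+ n) 0)))
  (ℚᵘₚ.<-respʳ-≃ (ℚᵘₚ.≃-sym (ℚₚ.toℚᵘ-fromℚᵘ (ℚᵘ.mkℚᵘ (+ suc n) 0)))
  (ℚᵘ.*<* (ℤₚ.*-monoʳ-<-pos (+ 1) (+<+ (ℕₚ.n<1+n n))))))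

<ℝ-respˡ-≃ : ∀ {x y z} → x ≃ y → y <ℝ z → x <ℝ z
<ℝ-respˡ-≃ (mk≃ _ u) (p , y<p , p<z) = p , Equivalence.from (u p) y<p , p<z

<ℝ-respʳ-≃ : ∀ {x y z} → y ≃ z → x <ℝ y → x <ℝ z
<ℝ-respʳ-≃ (mk≃ l _) (p , x<p , p<y) = p , x<p , Equivalence.to (l p) p<y

fromℕ-<-suc : ∀ n → fromℕ n <ℝ fromℕ (suc n)
-- Between embedded rationals, `_<ℝ_` asks for a rational strictly between them; density supplies
-- it.
fromℕ-<-suc n = ℚₚ.<-dense (n/1<1+n/1 n)

<ℝ-fromℕ-suc : ∀ {x} n → x <ℝ fromℕ n → x <ℝ fromℕ (suc n)
<ℝ-fromℕ-suc n (p , x<p , p<n) = p , x<p , ℚₚ.<-trans p<n (n/1<1+n/1 n)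

module _ {a} {U : Set a} (G : DistinctWeightedPairGraph U) where
  open DistinctWeightedPairGraph G hiding (V; A; q)

  -- Bounding the first weight bounds all of them.
  record TrailFrom (n : ℕ) (v : U) (k : ℕ) : Set a where
    field
      steps    : List (U × U)
      trail    : IsDecreasingTrail G steps
      length≡k : length steps ≡ k
      start    : Maybe.All (λ e → proj₁ e ≡ v × w e <ℝ fromℕ n) (head steps)

  open TrailFrom
  open IsDecreasingTrail

  emptyTrail : ∀ {n v} → TrailFrom n v 0
  emptyTrail = record
    { steps    = []
    ; trail    = record { arcs = [] ; decreasing = [] }
    ; length≡k = refl
    ; start    = nothing
    }

  weaken : ∀ {n v k} → TrailFrom n v k → TrailFrom (suc n) v k
  weaken {n} t = record
    { steps    = steps t
    ; trail    = trail t
    ; length≡k = length≡k t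
    ; start    = Maybe.map (λ {e} → map₂ (<ℝ-fromℕ-suc {w e} n)) (start t)
    }

  -- A first arc of `t`, if any, weighs strictly less than `n`, the weight of the new arc, so the
  -- longer trail still decreases; the new head has weight `n`, so the strict bound rises to
  -- `suc n`.
  prepend : ∀ {n x y k} → (x , y) ∈ₛ A G → w (x , y) ≃ fromℕ n →
            TrailFrom n y k → TrailFrom (suc n) x (k + 1)
  prepend {n} {x} {y} {k} e∈A we≃n t = record
    { steps    = (x , y) ∷ steps t
    ; trail    = record
      { arcs       = e∈A ∷ arcs (trail t)
      ; decreasing = connect (start t) ∷′ decreasing (trail t)
      }
    ; length≡k = trans (cong suc (length≡k t)) (ℕₚ.+-comm 1 k)
    ; start    = just (refl , <ℝ-respˡ-≃ {z = fromℕ (suc n)} we≃n (fromℕ-<-suc n))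
    }
    where
    connect : ∀ {m} → Maybe.All (λ e → proj₁ e ≡ y × w e <ℝ fromℕ n) m →
              Connected (DecreasingStep G) (just (x , y)) m
    connect nothing                    = just-nothing
    connect (just {e′} (refl , we′<n)) =
      just (refl , <ℝ-respʳ-≃ {w e′} (≃-sym we≃n) we′<n)

  -- Reversal is the second alternative in `weight-distinct`. This lets an arc of given weight be
  -- traversed from either end.
  w-symmetric : ∀ {x y} → (x , y) ∈ₛ A G → w (y , x) ≃ w (x , y)
  w-symmetric e∈A = Equivalence.from (weight-distinct (symmetric e∈A) e∈A) (inj₂ refl)

  -- A maximum equals one of its arguments, so one of the two trails already has the required
  -- length.
  longer : ∀ {n v j k} → TrailFrom n v j → TrailFrom n v k → TrailFrom n v (j ⊔ k)
  longer {n} {v} {j} {k} s t with ℕₚ.⊔-sel j k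
  ... | inj₁ j⊔k≡j = subst (TrailFrom n v) (sym j⊔k≡j) s
  ... | inj₂ j⊔k≡k = subst (TrailFrom n v) (sym j⊔k≡k) t

  module _ {ℓ} {_<_ : Rel U ℓ} (isSTO : IsStrictTotalOrder _≡_ _<_) where
    open IsStrictTotalOrder isSTO using (_≟_)

    relabel-trail : ∀ {n e L} → e ∈ₛ A G → w e ≃ fromℕ n →
                    (∀ v → TrailFrom n v (L v)) →
                    ∀ v → TrailFrom (suc n) v (relabel isSTO G (just e) L v)
    -- The case split follows the tests in `relabel`. At an end of `e`, the old trail from `v`
    -- competes with `e` followed by the old trail from the other end.
    relabel-trail {e = a , b} e∈A we≃n t v with v ≟ a
    ... | yes refl = longer (prepend e∈A we≃n (t b)) (weaken (t v))
    ... | no _ with v ≟ b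
    ...   | yes refl = longer
      (prepend (symmetric e∈A) (≃-trans (w-symmetric e∈A) we≃n) (t a)) (weaken (t v))
    ...   | no _     = weaken (t v)

    -- The strict bound `suc i` says that weights are at most `i`, and it is the weight of the arc
    -- handled next. Staying within `q G / 2` ensures that `firstArc` finds an arc at every step.
    getL-trail : ∀ {arcs} → arcs Enumerates A G → ∀ i → i ≤ q G / 2 →
                 ∀ v → TrailFrom (suc i) v (getL isSTO G arcs i v)
    getL-trail enum zero    _     v = emptyTrail
    getL-trail enum (suc i) i<q/2 v
      with firstArc-exists isSTO G enum (s≤s z≤n) i<q/2
    ... | e , first≡e , e∈A , we≃1+i rewrite first≡e =
      relabel-trail e∈A we≃1+i (getL-trail enum i (ℕₚ.<⇒≤ i<q/2)) v

mainTheorem8 : ∀ {a ℓ} {U : Set a} {_<_ : Rel U ℓ} (isSTO : IsStrictTotalOrder _≡_ _<_)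
    (G : DistinctWeightedPairGraph U)
    (arcs : List (U × U)) → arcs Enumerates (A G) →
    (k : ℕ) →
    (∃[ v ] (v ∈ₛ V G × getL isSTO G arcs (q G / 2) v ≡ k)) →
    ∃[ es ] (IsDecreasingTrail G es × length es ≡ k)
mainTheorem8 isSTO G arcs enum k (v , _ , refl) = steps , trail , length≡k
  where open TrailFrom (getL-trail G isSTO enum (q G / 2) ℕₚ.≤-refl v)
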